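{- Let $\tilde L$ be a minimum-size counterexample. For every meet-irreducible element $m$ of $\tilde L$ there exists a join-irreducible element $j$ of $\tilde L$ such that $j\le m$ and $|{\uparrow}j|=\frac{|\tilde L|+1}{2}$.
   Context: For a poset $P$, $x$ upper covers $y$ (and $y$ lower covers $x$) if $y<x$ with nothing strictly between. Join-irreducible: upper covers exactly one element; meet-irreducible: lower covers exactly one element. For $x\in P$, ${\uparrow}x=\{y\in P: x\le y\}$. A counterexample is a finite lattice $L$ with $|L|>1$ in which every join-irreducible $j$ satisfies $|{\uparrow}j|>|L|/2$; a minimum-size counterexample is a counterexample $\tilde L$ such that no counterexample has fewer elements. -}

module Defs where

open import Level using (Level; _⊔_; suc)
open import Data.Fin.Base using (Fin)
open import Data.Fin.Properties using (_≟_)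
open import Data.List.Base using (List; length; filter; tabulate)
open import Data.Nat.Base using (ℕ; _*_) renaming (_<_ to _<ℕ_)
open import Data.Product using (_×_; ∃; ∃!)
open import Function.Bundles using (Inverse)
open import Function.Properties.Inverse using (Inverse⇒Injection)
open import Relation.Binary.Bundles using (Poset)
open import Relation.Binary.Definitions using (Decidable)
open import Relation.Binary.Lattice.Bundles using (Lattice)
open import Relation.Binary.PropositionalEquality.Properties using (setoid)
open import Relation.Nullary.Decidable using (via-injection)
open import Relation.Nullary.Negation using (¬_)
import Relation.Binary.Construct.NonStrictToStrict as ToStrict
import Relation.Binary.Lattice.Properties.JoinSemilattice as JoinProperties

private
  variable
    c ℓ₁ ℓ₂ : Level

module Covering (P : Poset c ℓ₁ ℓ₂) where
  open Poset P using (Carrier; _≈_; _≤_)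
  open ToStrict _≈_ _≤_ using (_<_)

  infix 4 _UpperCovers_ _LowerCovers_

  _UpperCovers_ : Carrier → Carrier → Set (c ⊔ ℓ₁ ⊔ ℓ₂)
  x UpperCovers y = y < x × ¬ (∃ λ z → y < z × z < x)

  _LowerCovers_ : Carrier → Carrier → Set (c ⊔ ℓ₁ ⊔ ℓ₂)
  y LowerCovers x = x UpperCovers y

  JoinIrreducible : Carrier → Set (c ⊔ ℓ₁ ⊔ ℓ₂)
  JoinIrreducible j = ∃! _≈_ (λ y → j UpperCovers y)

  MeetIrreducible : Carrier → Set (c ⊔ ℓ₁ ⊔ ℓ₂)
  MeetIrreducible m = ∃! _≈_ (λ x → m LowerCovers x)

-- Elements are identified up to _≈_, so `size` is the number of
-- _≈_-classes.
record FiniteLattice c ℓ₁ ℓ₂ : Set (suc (c ⊔ ℓ₁ ⊔ ℓ₂)) where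
  field
    lattice     : Lattice c ℓ₁ ℓ₂
    size        : ℕ
    enumeration : Inverse (Lattice.setoid lattice) (setoid (Fin size))

  open Lattice lattice public hiding (setoid)
  open Covering poset public

  _≈?_ : Decidable _≈_
  _≈?_ = via-injection (Inverse⇒Injection enumeration) _≟_

  _≤?_ : Decidable _≤_
  _≤?_ = JoinProperties.≈-dec⇒≤-dec joinSemilattice _≈?_

  -- One representative of each _≈_-class, without repetition.
  elements : List Carrier
  elements = tabulate (Inverse.from enumeration)

  ∣↑_∣ : Carrier → ℕ
  ∣↑ x ∣ = length (filter (x ≤?_) elements)

∣_∣ : FiniteLattice c ℓ₁ ℓ₂ → ℕ
∣ L ∣ = FiniteLattice.size L

-- The inequality |↑j| > |L|/2 is stated with the denominator cleared.
IsCounterexample : FiniteLattice c ℓ₁ ℓ₂ → Set (c ⊔ ℓ₁ ⊔ ℓ₂)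
IsCounterexample L =
  1 <ℕ ∣ L ∣ × (∀ j → JoinIrreducible j → ∣ L ∣ <ℕ 2 * ∣↑ j ∣)
  where open FiniteLattice L using (JoinIrreducible; ∣↑_∣)

-- Competitors range over the universe levels of L; every finite lattice
-- has an isomorphic copy there.
IsMinimumCounterexample : FiniteLattice c ℓ₁ ℓ₂ → Set (suc (c ⊔ ℓ₁ ⊔ ℓ₂))
IsMinimumCounterexample {c} {ℓ₁} {ℓ₂} L =
  IsCounterexample L ×
  ((M : FiniteLattice c ℓ₁ ℓ₂) → IsCounterexample M → ¬ (∣ M ∣ <ℕ ∣ L ∣))

{-# OPTIONS --safe #-}
-- Let m* be the unique upper cover of m and delete m from L.  The rest is
-- again a lattice: meets are inherited, since m ≤ x ∧ y with x, y ≠ m forces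
-- m* ≤ x ∧ y, and a join equal to m is replaced by m*.  An element that is
-- join-irreducible after the deletion was so before, except possibly m*, in
-- which case m itself is join-irreducible in L and ↑m = {m} ∪ ↑m*.  Deleting m
-- shrinks ↑j by one if j ≤ m and not at all otherwise, so if no
-- join-irreducible j ≤ m attains (|L| + 1)/2, the smaller lattice is a
-- counterexample too.
module Submission where

open import Defs
open import Data.Fin.Base using (Fin; zero; suc; punchIn; punchOut)
open import Data.Fin.Induction using (spo-noetherian)
open import Data.Fin.Properties
  using (any?; all?; punchInᵢ≢i; punchIn-punchOut; punchOut-cong; punchOut-punchIn)
open import Data.List.Base using (length; filter; tabulate)
open import Data.List.Properties using (length-filter; length-tabulate)
open import Data.Nat.Base as ℕ using (ℕ; zero; suc; _+_; _*_; z≤n; s≤s)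
import Data.Nat.Properties as ℕ
open import Data.Product.Base using (_×_; _,_; ∃; proj₁; proj₂)
open import Function.Base using (flip; _∘_)
open import Function.Bundles using (Injection; Inverse)
open import Function.Properties.Inverse using (Inverse⇒Injection)
open import Induction.WellFounded using (Acc; acc)
open import Level using (Level)
open import Relation.Binary.Bundles using (Poset)
open import Relation.Binary.Definitions using (Decidable)
open import Relation.Binary.Lattice.Bundles using (Lattice)
open import Relation.Binary.Lattice.Definitions using (Infimum; Supremum)
open import Relation.Binary.PropositionalEquality.Core
  using (_≡_; _≢_; refl; sym; trans; cong; subst)
open import Relation.Binary.PropositionalEquality.Properties using (setoid)
open import Relation.Nullary.Decidable
  using (Dec; yes; no; False; fromWitnessFalse; toWitnessFalse; map′; _×-dec_)
open import Relation.Nullary.Negation using (¬_; contradiction)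
import Relation.Binary.Construct.NonStrictToStrict as ToStrict
import Relation.Binary.Construct.On as On
import Relation.Binary.Properties.Poset as PosetProperties
import Relation.Unary as U

private
  variable
    a b c p q ℓ₁ ℓ₂ : Level
    n : ℕ

-- Counting in tabulated lists.

module _ {A : Set a} {B : Set b} {P : U.Pred A p} {Q : U.Pred B q}
         (P? : U.Decidable P) (Q? : U.Decidable Q) where

  length-filter-tabulate-mono :
    (f : Fin n → A) (g : Fin n → B) → (∀ i → P (f i) → Q (g i)) →
    length (filter P? (tabulate f)) ℕ.≤ length (filter Q? (tabulate g))
  length-filter-tabulate-mono {n = zero}  f g P⇒Q = z≤n
  length-filter-tabulate-mono {n = suc n} f g P⇒Q
    with P? (f zero) | Q? (g zero)
       | length-filter-tabulate-mono (f ∘ suc) (g ∘ suc) (P⇒Q ∘ suc)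
  ... | yes _  | yes _  | ih = s≤s ih
  ... | yes pf | no ¬qg | _  = contradiction (P⇒Q zero pf) ¬qg
  ... | no _   | yes _  | ih = ℕ.m≤n⇒m≤1+n ih
  ... | no _   | no _   | ih = ih

  -- The summand r accounts for f k, the only entry of f without a partner in g.
  length-filter-tabulate-punchIn :
    (f : Fin (suc n) → A) (g : Fin n → B) (k : Fin (suc n)) (r : ℕ) →
    (P (f k) → 1 ℕ.≤ r) → (∀ i → P (f (punchIn k i)) → Q (g i)) →
    length (filter P? (tabulate f)) ℕ.≤ length (filter Q? (tabulate g)) + r
  length-filter-tabulate-punchIn f g zero r 1≤r P⇒Q
    with P? (f zero) | length-filter-tabulate-mono (f ∘ suc) g P⇒Q
  ... | yes pf | le = ℕ.≤-trans (ℕ.≤-reflexive (ℕ.+-comm 1 _)) (ℕ.+-mono-≤ le (1≤r pf))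
  ... | no _   | le = ℕ.m≤n⇒m≤n+o r le
  length-filter-tabulate-punchIn {n = suc n} f g (suc k) r 1≤r P⇒Q
    with P? (f zero) | Q? (g zero)
       | length-filter-tabulate-punchIn (f ∘ suc) (g ∘ suc) k r 1≤r (P⇒Q ∘ suc)
  ... | yes _  | yes _  | ih = s≤s ih
  ... | yes pf | no ¬qg | _  = contradiction (P⇒Q zero pf) ¬qg
  ... | no _   | yes _  | ih = ℕ.m≤n⇒m≤1+n ih
  ... | no _   | no _   | ih = ih

Fin-irrelevant : n ℕ.≤ 1 → (i j : Fin n) → i ≡ j
Fin-irrelevant (s≤s z≤n) zero zero = refl

-- Join-irreducibles of finite posets.

module FinitePoset (P : Poset c ℓ₁ ℓ₂)
                   (enumeration : Inverse (Poset.Eq.setoid P) (setoid (Fin n)))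
                   (_≈?_ : Decidable (Poset._≈_ P)) (_≤?_ : Decidable (Poset._≤_ P)) where
  open Poset P using (Carrier; _≈_; _≤_; module Eq; reflexive) renaming (trans to ≤-trans)
  open PosetProperties P
  open Covering P
  open Inverse enumeration

  _<?_ : Decidable _<_
  _<?_ = ToStrict.<-decidable _≈_ _≤_ _≈?_ _≤?_

  -- In a finite poset this is join-irreducibility of `j` with lower cover `y`, in a form decidable
  -- without a search for covers.
  _IsGreatestBelow_ : Carrier → Carrier → Set _
  y IsGreatestBelow j = y < j × (∀ {x} → x < j → x ≤ y)

  isGreatestBelow-respʳ-≈ : ∀ {y j k} → j ≈ k → y IsGreatestBelow j → y IsGreatestBelow k
  isGreatestBelow-respʳ-≈ j≈k (y<j , x<j⇒x≤y) =
    <-respʳ-≈ j≈k y<j , x<j⇒x≤y ∘ <-respʳ-≈ (Eq.sym j≈k)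

  isGreatestBelow-respˡ-≈ : ∀ {y z j} → y ≈ z → y IsGreatestBelow j → z IsGreatestBelow j
  isGreatestBelow-respˡ-≈ y≈z (y<j , x<j⇒x≤y) =
    <-respˡ-≈ y≈z y<j , λ x<j → ≤-trans (x<j⇒x≤y x<j) (reflexive y≈z)

  _isGreatestBelow?_ : Decidable _IsGreatestBelow_
  y isGreatestBelow? j = (y <? j) ×-dec map′ extend (λ x<j⇒x≤y _ → x<j⇒x≤y) (all? below?)
    where
    Below : Fin n → Set _
    Below i = from i < j → from i ≤ y

    below? : U.Decidable Below
    below? i with from i <? j | from i ≤? y
    ... | _      | yes le = yes λ _ → le
    ... | yes lt | no ¬le = no λ h → ¬le (h lt)
    ... | no ¬lt | no _   = yes λ lt → contradiction lt ¬lt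

    -- Every `x` is equivalent to its representative `from (to x)`, so testing the representatives
    -- suffices.
    extend : (∀ i → Below i) → ∀ {x} → x < j → x ≤ y
    extend h {x} x<j =
      ≤-trans (reflexive (Eq.sym x≈)) (h (to x) (<-respˡ-≈ (Eq.sym x≈) x<j))
      where x≈ = strictlyInverseʳ x

  -- A lower cover `z` of `j` other than `y` would have `y` strictly between itself and `j`.
  isGreatestBelow⇒joinIrreducible : ∀ {y j} → y IsGreatestBelow j → JoinIrreducible j
  isGreatestBelow⇒joinIrreducible {y} {j} (y<j , x<j⇒x≤y) =
    y , (y<j , λ (_ , y<z , z<j) → <⇒≱ y<z (x<j⇒x≤y z<j)) , unique
    where
    unique : ∀ {z} → j UpperCovers z → y ≈ z
    unique {z} (z<j , none) with z ≈? y
    ... | yes z≈y = Eq.sym z≈y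
    ... | no  z≉y = contradiction (y , (x<j⇒x≤y z<j , z≉y) , y<j) none

  -- Climb from x towards j: the climb ends at a lower cover of j, hence at y.
  uniqueCover⇒greatest : ∀ {y j} → (∀ {z} → j UpperCovers z → y ≈ z) →
                         ∀ {x} → x < j → x ≤ y
  uniqueCover⇒greatest {y} {j} unique {x} x<j =
    ≤-trans (reflexive (Eq.sym x≈))
            (climb (to x) (noetherian (to x)) (<-respˡ-≈ (Eq.sym x≈) x<j))
    where
    x≈ = strictlyInverseʳ x
    noetherian = spo-noetherian (On.isStrictPartialOrder from <-isStrictPartialOrder)

    climb : ∀ i → Acc (λ k l → from l < from k) i → from i < j → from i ≤ y
    climb i (acc rec) i<j with any? (λ k → (from i <? from k) ×-dec (from k <? j))
    ... | yes (k , i<k , k<j) = ≤-trans (proj₁ i<k) (climb k (rec i<k) k<j)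
    ... | no none = reflexive (Eq.sym (unique (i<j , λ (z , i<z , z<j) →
          let z≈ = Eq.sym (strictlyInverseʳ z) in
          none (to z , <-respʳ-≈ z≈ i<z , <-respˡ-≈ z≈ z<j))))

module FiniteLatticeProperties (L : FiniteLattice c ℓ₁ ℓ₂) where
  open FiniteLattice L
  open PosetProperties poset using (_<_; ≥-poset)
  open FinitePoset poset enumeration _≈?_ _≤?_ public

  private
    module Dual = FinitePoset ≥-poset enumeration _≈?_ (flip _≤?_)

  -- Order dual of `uniqueCover⇒greatest`. Strictness contains an oriented `≉`, which `Eq.sym` turns
  -- round.
  uniqueCover⇒least : ∀ {x m} → (∀ {z} → m LowerCovers z → x ≈ z) →
                      ∀ {z} → m < z → x ≤ z
  uniqueCover⇒least unique (m≤z , m≉z) = Dual.uniqueCover⇒greatest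
    (λ ((m≤z , z≉m) , none) → unique
      ( (m≤z , z≉m ∘ Eq.sym)
      , λ (w , (m≤w , m≉w) , (w≤z , w≉z)) → none (w , (w≤z , w≉z ∘ Eq.sym) , (m≤w , m≉w ∘ Eq.sym))))
    (m≤z , m≉z ∘ Eq.sym)

-- Deleting an element that has a least element strictly above it.

module Deletion
  (𝐋 : Lattice c ℓ₁ ℓ₂) (E : Inverse (Lattice.setoid 𝐋) (setoid (Fin (suc n))))
  (m m* : Lattice.Carrier 𝐋) (m<m* : PosetProperties._<_ (Lattice.poset 𝐋) m m*)
  (m*-least : ∀ {x} → PosetProperties._<_ (Lattice.poset 𝐋) m x → Lattice._≤_ 𝐋 m* x)
  where

  private
    -- Reassembled from separate parameters so that its size is literally `suc n` and the deletion
    -- has size `n`.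
    L : FiniteLattice c ℓ₁ ℓ₂
    L = record { lattice = 𝐋 ; size = suc n ; enumeration = E }

  open FiniteLattice L hiding (refl; trans)
  open FiniteLatticeProperties L
  open PosetProperties poset using (_<_; <⇒≱)

  private
    module ≤ = Lattice 𝐋
    module E = Inverse E

  -- `False` keeps the carrier in the universe of L.
  Carrier⁻ : Set _
  Carrier⁻ = ∃ λ x → False (x ≈? m)

  ≉m : (x : Carrier⁻) → ¬ (proj₁ x ≈ m)
  ≉m x = toWitnessFalse (proj₂ x)

  inject : ∀ x → ¬ (x ≈ m) → Carrier⁻
  inject x x≉m = x , fromWitnessFalse x≉m

  m≤⇒m*≤ : (x : Carrier⁻) → m ≤ proj₁ x → m* ≤ proj₁ x
  m≤⇒m*≤ x m≤x = m*-least (m≤x , ≉m x ∘ Eq.sym)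

  m*⁻ : Carrier⁻
  m*⁻ = inject m* (proj₂ m<m* ∘ Eq.sym)

  join : Carrier⁻ → Carrier⁻ → Carrier⁻
  join (x , _) (y , _) with (x ∨ y) ≈? m
  ... | yes _    = m*⁻
  ... | no x∨y≉m = inject (x ∨ y) x∨y≉m

  join-supremum : Supremum (λ x y → proj₁ x ≤ proj₁ y) join
  join-supremum (x , _) (y , _) with (x ∨ y) ≈? m
  ... | no _      = ≤.x≤x∨y x y , ≤.y≤x∨y x y , λ _ → ≤.∨-least
  -- A common upper bound that survives the deletion lies above `m` without being equal to it, hence
  -- above `m*`.
  ... | yes x∨y≈m =
    ≤.trans (≤.x≤x∨y x y) x∨y≤m* ,
    ≤.trans (≤.y≤x∨y x y) x∨y≤m* ,
    λ z x≤z y≤z → m≤⇒m*≤ z (≤.trans (≤.reflexive (Eq.sym x∨y≈m)) (≤.∨-least x≤z y≤z))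
    where x∨y≤m* = ≤.trans (≤.reflexive x∨y≈m) (proj₁ m<m*)

  meet : Carrier⁻ → Carrier⁻ → Carrier⁻
  meet x′@(x , _) y′@(y , _) = inject (x ∧ y) λ x∧y≈m →
    let m≤x∧y = ≤.reflexive (Eq.sym x∧y≈m) in
    <⇒≱ m<m* (≤.trans
      (≤.∧-greatest (m≤⇒m*≤ x′ (≤.trans m≤x∧y (≤.x∧y≤x x y)))
                    (m≤⇒m*≤ y′ (≤.trans m≤x∧y (≤.x∧y≤y x y))))
      (≤.reflexive x∧y≈m))

  meet-infimum : Infimum (λ x y → proj₁ x ≤ proj₁ y) meet
  meet-infimum (x , _) (y , _) = ≤.x∧y≤x x y , ≤.x∧y≤y x y , λ _ → ≤.∧-greatest

  lattice⁻ : Lattice c ℓ₁ ℓ₂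
  lattice⁻ = record
    { Carrier   = Carrier⁻
    ; _≈_       = λ x y → proj₁ x ≈ proj₁ y
    ; _≤_       = λ x y → proj₁ x ≤ proj₁ y
    ; _∨_       = join
    ; _∧_       = meet
    ; isLattice = record
      { isPartialOrder = On.isPartialOrder proj₁ ≤.isPartialOrder
      ; supremum       = join-supremum
      ; infimum        = meet-infimum
      }
    }

  from-≉m : ∀ i → i ≢ E.to m → ¬ (E.from i ≈ m)
  from-≉m i i≢ fi≈m = i≢ (trans (sym (E.strictlyInverseˡ i)) (E.to-cong fi≈m))

  to-≢ : (x : Carrier⁻) → E.to m ≢ E.to (proj₁ x)
  to-≢ x eq = ≉m x (Eq.trans (Eq.sym (E.strictlyInverseʳ _))
                     (Eq.trans (E.from-cong (sym eq)) (E.strictlyInverseʳ m)))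

  -- Skipping the index of `m` with `punchIn` keeps the order of the other entries, as
  -- `length-filter-tabulate-punchIn` expects.
  enumeration⁻ : Inverse (Lattice.setoid lattice⁻) (setoid (Fin n))
  enumeration⁻ = record
    { to        = to⁻
    ; from      = from⁻
    ; to-cong   = λ {x} {y} → to⁻-cong {x} {y}
    ; from-cong = λ { refl → Eq.refl }
    ; inverse   =
        (λ {i} {x} x≈ → trans (to⁻-cong {x} {from⁻ i} x≈)
          (trans (punchOut-cong (E.to m) (E.strictlyInverseˡ _)) (punchOut-punchIn (E.to m))))
      , (λ { {x} refl → Eq.trans (E.from-cong (punchIn-punchOut (to-≢ x))) (E.strictlyInverseʳ _) })
    }
    where
    to⁻ : Carrier⁻ → Fin n
    to⁻ x = punchOut (to-≢ x)

    from⁻ : Fin n → Carrier⁻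
    from⁻ i = inject (E.from (punchIn (E.to m) i)) (from-≉m _ (punchInᵢ≢i (E.to m) i))

    to⁻-cong : ∀ {x y} → proj₁ x ≈ proj₁ y → to⁻ x ≡ to⁻ y
    to⁻-cong x≈y = punchOut-cong (E.to m) (E.to-cong x≈y)

  L⁻ : FiniteLattice c ℓ₁ ℓ₂
  L⁻ = record { lattice = lattice⁻ ; size = n ; enumeration = enumeration⁻ }

  private
    module L⁻ where
      open FiniteLattice L⁻ public
      open FiniteLatticeProperties L⁻ public

  -- Upper sets and join-irreducibles after the deletion.

  -- Only `m` can be lost from the upper set of `x`, and `r` pays for it: 0 if `m` is not above `x`,
  -- else 1. A separate `y` allows `x` to be `m` itself.
  ∣↑∣-delete : ∀ {x} y r → (x ≤ m → 1 ℕ.≤ r) →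
               (∀ (z : Carrier⁻) → x ≤ proj₁ z → proj₁ y ≤ proj₁ z) →
               ∣↑ x ∣ ℕ.≤ L⁻.∣↑ y ∣ + r
  ∣↑∣-delete {x} y r 1≤r x≤⇒y≤ =
    length-filter-tabulate-punchIn (x ≤?_) (y L⁻.≤?_) E.from (Inverse.from enumeration⁻)
      (E.to m) r (λ x≤fm → 1≤r (≤.trans x≤fm (≤.reflexive (E.strictlyInverseʳ m))))
      (λ i → x≤⇒y≤ (Inverse.from enumeration⁻ i))

  -- Let `y` be greatest below `j` after the deletion. Putting `m` back spoils this only if `m ≤ j`
  -- but not `m ≤ y`; then `m` replaces `j`.
  joinIrreducible⁻⇒joinIrreducible : ∀ j → L⁻.JoinIrreducible j →
    ∃ λ x → (∃ λ y → y IsGreatestBelow x) × (∀ (z : Carrier⁻) → x ≤ proj₁ z → proj₁ j ≤ proj₁ z)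
  joinIrreducible⁻⇒joinIrreducible j′@(j , _) (y′@(y , _) , (y<j , _) , unique)
    with L⁻.uniqueCover⇒greatest {y′} {j′} (λ {z} → unique {z})
       | m ≤? j | m ≤? y
  ... | greatest | no m≰j | _ =
    j , (y , y<j , λ {x} x<j →
      greatest {inject x λ x≈m → m≰j (≤.trans (≤.reflexive (Eq.sym x≈m)) (proj₁ x<j))} x<j) ,
    λ _ j≤z → j≤z
  ... | greatest | _ | yes m≤y = j , (y , y<j , below) , λ _ j≤z → j≤z
    where
    below : ∀ {x} → x < j → x ≤ y
    below {x} x<j with x ≈? m
    ... | yes x≈m = ≤.trans (≤.reflexive x≈m) m≤y
    ... | no  x≉m = greatest {inject x x≉m} x<j
  -- Here `j` is `m*`. Whatever is strictly below `m` survives and is strictly below `j`, hence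
  -- below `y`.
  ... | greatest | yes m≤j | no m≰y =
    m , (m ∧ y , m∧y<m , below) , λ z m≤z → ≤.trans j≤m* (m≤⇒m*≤ z m≤z)
    where
    m∧y<m : m ∧ y < m
    m∧y<m = ≤.x∧y≤x m y , λ m∧y≈m → m≰y (≤.trans (≤.reflexive (Eq.sym m∧y≈m)) (≤.x∧y≤y m y))

    below : ∀ {x} → x < m → x ≤ m ∧ y
    below {x} (x≤m , x≉m) = ≤.∧-greatest x≤m (greatest {inject x x≉m}
      (≤.trans x≤m m≤j , λ x≈j → x≉m (≤.antisym x≤m (≤.trans m≤j (≤.reflexive (Eq.sym x≈j))))))

    j≤m* : j ≤ m*
    j≤m* with m* ≈? j
    ... | yes m*≈j = ≤.reflexive (Eq.sym m*≈j)
    -- Strictly below `j`, `m*` would lie below `y`, and `m` with it.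
    ... | no  m*≉j = contradiction
      (≤.trans (proj₁ m<m*) (greatest {m*⁻} (m≤⇒m*≤ j′ m≤j , m*≉j))) m≰y

  -- Otherwise L is the two-element chain m < m*, with ↑m* = {m*}.
  1<size⁻ : IsCounterexample L → 1 ℕ.< n
  1<size⁻ (_ , large) with 1 ℕ.<? n
  ... | yes 1<n = 1<n
  -- From `suc n < 2 * ∣↑ m* ∣` and `∣↑ m* ∣ ≤ n`, cancelling `n` yields the goal itself.
  ... | no  1≮n = ℕ.+-cancelʳ-< n 1 n
    (subst (suc n ℕ.<_) (cong (n +_) (ℕ.+-identityʳ n)) (ℕ.<-≤-trans
      (large m* (isGreatestBelow⇒joinIrreducible (m<m* , below)))
      (ℕ.*-monoʳ-≤ 2 ∣↑m*∣≤n)))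
    where
    below : ∀ {x} → x < m* → x ≤ m
    below {x} (x≤m* , x≉m*) with x ≈? m
    ... | yes x≈m = ≤.reflexive x≈m
    ... | no  x≉m = contradiction
      (Injection.injective (Inverse⇒Injection enumeration⁻) {inject x x≉m} {m*⁻}
        (Fin-irrelevant (ℕ.≮⇒≥ 1≮n) _ _)) x≉m*

    ∣↑m*∣≤n : ∣↑ m* ∣ ℕ.≤ n
    ∣↑m*∣≤n = ℕ.≤-trans
      (∣↑∣-delete m*⁻ 0 (λ m*≤m → contradiction m*≤m (<⇒≱ m<m*)) (λ _ le → le))
      (ℕ.≤-trans (ℕ.≤-reflexive (ℕ.+-identityʳ _))
        (ℕ.≤-trans (length-filter (m*⁻ L⁻.≤?_) L⁻.elements)
                   (ℕ.≤-reflexive (length-tabulate _))))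

  -- Indices and an explicit greatest element below make existence decidable by finite search, so
  -- the final case split is constructive.
  Tight : Fin (suc n) → Set _
  Tight i = (∃ λ k → E.from k IsGreatestBelow E.from i)
          × E.from i ≤ m × 2 * ∣↑ E.from i ∣ ≡ suc n + 1

  tight? : U.Decidable Tight
  tight? i = any? (λ k → E.from k isGreatestBelow? E.from i)
       ×-dec (E.from i ≤? m) ×-dec (2 * ∣↑ E.from i ∣ ℕ.≟ suc n + 1)

  ¬tight⇒counterexample⁻ : IsCounterexample L → ¬ ∃ Tight → IsCounterexample L⁻
  ¬tight⇒counterexample⁻ cex@(_ , large) ¬tight = 1<size⁻ cex , large⁻
    where
    large⁻ : ∀ j → L⁻.JoinIrreducible j → n ℕ.< 2 * L⁻.∣↑ j ∣
    large⁻ j ji with joinIrreducible⁻⇒joinIrreducible j ji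
    ... | x , (y , y-greatest) , x≤⇒j≤ = cases (E.from i ≤? m)
      where
      -- `Tight` speaks of representatives only, so `x` is exchanged for its own.
      i  = E.to x
      x≈ = Eq.sym (E.strictlyInverseʳ x)
      below = isGreatestBelow-respʳ-≈ x≈ y-greatest

      upper : ∀ (z : Carrier⁻) → E.from i ≤ proj₁ z → proj₁ j ≤ proj₁ z
      upper z i≤z = x≤⇒j≤ z (≤.trans (≤.reflexive x≈) i≤z)

      large-i : suc n ℕ.< 2 * ∣↑ E.from i ∣
      large-i = large _ (isGreatestBelow⇒joinIrreducible below)

      cases : Dec (E.from i ≤ m) → n ℕ.< 2 * L⁻.∣↑ j ∣
      -- The upper set loses nothing, while the size drops by one.
      cases (no i≰m) = ℕ.<-trans (ℕ.n<1+n n) (ℕ.<-≤-trans large-i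
        (ℕ.*-monoʳ-≤ 2 (subst (∣↑ E.from i ∣ ℕ.≤_) (ℕ.+-identityʳ _)
          (∣↑∣-delete j 0 (λ i≤m → contradiction i≤m i≰m) upper))))
      -- The loss of `m` costs 2 after doubling. `large-i` gives `n + 2` as a lower bound, and the
      -- failure of tightness makes it strict.
      cases (yes i≤m) = ℕ.+-cancelʳ-< 2 n _ (begin-strict
        n + 2                    ≡⟨ ℕ.+-suc n 1 ⟩
        suc n + 1                <⟨ ℕ.≤∧≢⇒< n+2≤2∣↑i∣ (not-tight ∘ sym) ⟩
        2 * ∣↑ E.from i ∣        ≤⟨ ℕ.*-monoʳ-≤ 2 (∣↑∣-delete j 1 (λ _ → ℕ.≤-refl) upper) ⟩
        2 * (L⁻.∣↑ j ∣ + 1)      ≡⟨ ℕ.*-distribˡ-+ 2 L⁻.∣↑ j ∣ 1 ⟩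
        2 * L⁻.∣↑ j ∣ + 2        ∎)
        where
        open ℕ.≤-Reasoning

        n+2≤2∣↑i∣ : suc n + 1 ℕ.≤ 2 * ∣↑ E.from i ∣
        n+2≤2∣↑i∣ = ℕ.≤-trans (ℕ.≤-reflexive (ℕ.+-comm (suc n) 1)) large-i

        not-tight : 2 * ∣↑ E.from i ∣ ≢ suc n + 1
        not-tight eq = ¬tight
          (i , (E.to y , isGreatestBelow-respˡ-≈ (Eq.sym (E.strictlyInverseʳ y)) below) , i≤m , eq)

-- Minimality against the deletion.

theorem2p12 : ∀ {c ℓ₁ ℓ₂} (L : FiniteLattice c ℓ₁ ℓ₂) → IsMinimumCounterexample L →
    let open FiniteLattice L in
    (m : Carrier) → MeetIrreducible m →
    ∃ λ (j : Carrier) → JoinIrreducible j × j ≤ m × 2 * ∣↑ j ∣ ≡ ∣ L ∣ + 1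
-- A counterexample has more than one element, so its size is a successor.
theorem2p12 record { size = zero } ((() , _) , _)
theorem2p12 L@record { lattice = 𝐋 ; size = suc n ; enumeration = E } (cex , minimal)
            m (m* , (m<m* , _) , unique) = conclude (any? tight?)
  where
  open FiniteLattice L
  open FiniteLatticeProperties L
  open Deletion 𝐋 E m m* m<m* (uniqueCover⇒least λ {z} → unique {z})

  conclude : Dec (∃ Tight) → ∃ λ j → JoinIrreducible j × j ≤ m × 2 * ∣↑ j ∣ ≡ suc n + 1
  conclude (yes (i , (_ , below) , i≤m , eq)) =
    _ , isGreatestBelow⇒joinIrreducible below , i≤m , eq
  conclude (no ¬tight) =
    contradiction (ℕ.n<1+n n) (minimal L⁻ (¬tight⇒counterexample⁻ cex ¬tight))
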